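{- For every $m\ge1$ there is a bijection between the set $\widehat{\mathcal{T}}(m)$ of unordered unilabelled-bilabelled increasing trees with label set $\{1,\dots,m\}$ and the disjoint union $\widehat{\mathcal{Q}}(m)\,\dot\cup\,\widehat{\mathcal{Q}}(m-1)$, where $\widehat{\mathcal{Q}}(j)$ is the set of unordered increasing trees with $j$ nodes in which each node of out-degree at least $2$ is coloured either black or white (nodes of out-degree $0$ or $1$ being white), and $\widehat{\mathcal{Q}}(0)=\emptyset$.
   Context: An unordered unilabelled-bilabelled increasing tree with label set $\{1,\dots,m\}$ is a rooted non-plane tree in which each node carries a set of one or two labels, these sets partitioning $\{1,\dots,m\}$, such that every label of a child is larger than every label of its parent. An unordered increasing tree with $j$ nodes is a rooted non-plane tree whose nodes carry the distinct labels $1,\dots,j$ such that each child has a larger label than its parent. The out-degree of a node is its number of children. -}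

module Defs where

open import Data.Nat using (ℕ; zero; suc; _+_; _≤_; _<_)
open import Data.Fin as Fin using (Fin; toℕ; inject₁; fromℕ)
open import Data.Bool using (Bool; true; false; if_then_else_)
open import Data.Product using (_×_; _,_; proj₁; proj₂; Σ)
open import Data.List as List using (List; []; _∷_; length; filter)
open import Data.Vec as Vec using (Vec; lookup; tabulate; toList)
open import Data.List.Relation.Unary.All as LAll using ()
open import Data.List.Relation.Unary.Linked using (Linked)
open import Data.Vec.Relation.Unary.All as VAll using ()
open import Data.Vec.Relation.Binary.Pointwise.Inductive using (Pointwise)
open import Relation.Nullary using (does)
open import Data.Nat.ListAction using (sum)
open import Relation.Binary.PropositionalEquality using (_≡_)

-- Rooted trees on the node set {0,…,n-1} in which every non-root node k
-- has a parent among the nodes 0,…,k-1 (node 0 is the root).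
-- 'root' is the one-node tree; 't ▷ p' adds node n with parent p.
-- There are no trees with 0 nodes.

data Parents : ℕ → Set where
  root : Parents 1
  _▷_  : ∀ {n} → Parents n → Fin n → Parents (suc n)

edges : ∀ {n} → Parents n → List (Fin n × Fin n)
edges root      = []
edges {suc n} (t ▷ p) =
  (inject₁ p , fromℕ n) ∷ List.map (λ e → inject₁ (proj₁ e) , inject₁ (proj₂ e)) (edges t)

outdeg : ∀ {n} → Parents n → Fin n → ℕ
outdeg t i = length (filter (λ e → proj₁ e Fin.≟ i) (edges t))

outdegrees : ∀ {n} → Parents n → Vec ℕ n
outdegrees t = tabulate (outdeg t)

-- Q̂(j): unordered increasing trees with j nodes, node i carrying label
-- i+1 (so "parent label < child label" is exactly the Parents shape),
-- with each node coloured white (false) or black (true), where black is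
-- only allowed for nodes of out-degree ≥ 2.

data Allowed (d : ℕ) : Bool → Set where
  white : Allowed d false
  black : 2 ≤ d → Allowed d true

record QHat (j : ℕ) : Set where
  constructor qtree
  field
    tree     : Parents j
    colour   : Vec Bool j
    colourOK : Pointwise Allowed (outdegrees tree) colour

-- Note: Parents 0 is empty, so QHat 0 is empty, as required.

-- T̂(m): unordered unilabelled-bilabelled increasing trees on {1,…,m}
-- (labels represented by Fin m, i.e. label ℓ+1 ↦ ℓ).

data LabelSet (m : ℕ) : Set where
  one : Fin m → LabelSet m
  two : (a b : Fin m) → toℕ a < toℕ b → LabelSet m

minL : ∀ {m} → LabelSet m → ℕ
minL (one a)     = toℕ a
minL (two a b _) = toℕ a

maxL : ∀ {m} → LabelSet m → ℕ
maxL (one a)     = toℕ a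
maxL (two a b _) = toℕ b

occ : ∀ {m} → Fin m → LabelSet m → ℕ
occ ℓ (one a)     = if does (ℓ Fin.≟ a) then 1 else 0
occ ℓ (two a b _) = (if does (ℓ Fin.≟ a) then 1 else 0) + (if does (ℓ Fin.≟ b) then 1 else 0)

occurrences : ∀ {m n} → Fin m → Vec (LabelSet m) n → ℕ
occurrences ℓ L = sum (List.map (occ ℓ) (toList L))

-- A tree with n nodes, node k carrying the label set (labels k).
-- To identify isomorphic copies, the nodes are listed in increasing
-- order of their smallest label (nodesSorted); in an increasing tree a
-- parent then always precedes its child, so the Parents shape is no
-- restriction.
record THat (m : ℕ) : Set where
  constructor ttree
  field
    n           : ℕ
    tree        : Parents n
    labels      : Vec (LabelSet m) n
    nodesSorted : Linked (λ A B → minL A < minL B) (toList labels)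
    partition   : VAll.All (λ ℓ → occurrences ℓ labels ≡ 1) (Vec.allFin m)
    increasing  : LAll.All (λ e → maxL (lookup labels (proj₁ e)) < minL (lookup labels (proj₂ e)))
                           (edges tree)

{-# OPTIONS --safe #-}
module Submission where

-- Build a multilabelled tree by inserting the labels in increasing order. The root has label set {1}
-- or {1,2}; after that each new label is either put on a new leaf below any node, or added to a
-- non-root unilabelled leaf. With o the number of nodes that cannot take a second label and u the
-- number of those that can, this is the growth process
--   o → o u,    u → o u  or  u → o.
-- A coloured tree grows in the same way if its last node is removed together with the colour of its
-- parent (which becomes white): only white nodes receive children, a white leaf becomes a white
-- internal node plus a leaf, and a white internal node stays white or turns black, plus a leaf. So
-- white leaves behave like o and white internal nodes like u. The two processes start with one o, at
-- label 1 or at label 2 according to the root of the multilabelled tree, which gives the two summands.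

open import Defs
open import Axiom.UniquenessOfIdentityProofs.WithK using (uip)
open import Data.Bool using (Bool; true; false)
open import Data.Fin as Fin using (Fin; zero; suc; toℕ; inject₁; fromℕ)
open import Data.Fin.Properties as Finₚ using (fromℕ≢inject₁; inject₁-injective; toℕ-inject₁; toℕ-fromℕ; toℕ<n)
open import Data.Fin.Relation.Unary.Top using (view; ‵fromℕ; ‵inject₁)
open import Data.List as List using (List; []; _∷_; length; filter)
open import Data.List.Membership.Propositional using (_∈_)
open import Data.List.Membership.Propositional.Properties using (∈-map⁺)
open import Data.List.Properties using (filter-accept; filter-reject)
open import Data.List.Relation.Unary.All as LAll using ()
open import Data.List.Relation.Unary.All.Properties as LAllₚ using ()
open import Data.List.Relation.Unary.AllPairs using (AllPairs; []; _∷_)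
open import Data.List.Relation.Unary.Any using (here; there)
open import Data.List.Relation.Unary.Linked as Linked using (Linked)
open import Data.List.Relation.Unary.Linked.Properties using (AllPairs⇒Linked; Linked⇒AllPairs)
open import Data.Nat using (ℕ; zero; suc; _+_; _≤_; _<_; _∸_; z≤n; s≤s; s≤s⁻¹)
open import Data.Nat.Properties as ℕ using (≤-irrelevant; <-irrelevant; <-trans; <-≤-trans; <-irrefl; suc-injective)
open import Data.Product using (Σ; ∃; _×_; _,_; proj₁; proj₂)
open import Data.Product.Properties using (,-injectiveˡ; ,-injectiveʳ-≡)
open import Data.Sum using (_⊎_; inj₁; inj₂)
open import Data.Sum.Properties using (inj₁-injective; inj₂-injective)
open import Data.Vec as Vec using (Vec; []; _∷_; _∷ʳ_; lookup; tabulate; toList; _[_]≔_; initLast)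
open import Data.Vec.Properties using (lookup-map; lookup∘update; lookup∘update′; lookup∘tabulate; tabulate∘lookup; tabulate-cong; ∷ʳ-injective; []≔-idempotent; []≔-lookup)
open import Data.Vec.Relation.Binary.Pointwise.Extensional using (ext; extensional⇒inductive)
open import Data.Vec.Relation.Binary.Pointwise.Inductive as Pointwise using (Pointwise)
open import Data.Vec.Relation.Unary.All as VAll using ()
open import Data.Vec.Relation.Unary.All.Properties as VAllₚ using ()
open import Function using (_∘_; id; _⤖_; mk⤖)
open import Function.Consequences.Propositional using (strictlySurjective⇒surjective)
open import Function.Properties.Bijection using (⤖⇒↔)
open import Function.Properties.Inverse using (↔⇒⤖; ↔-sym; ↔-trans)
open import Relation.Binary.PropositionalEquality using (_≡_; _≢_; refl; sym; trans; cong; cong₂; subst; subst₂; module ≡-Reasoning)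
open import Relation.Nullary using (¬_; yes; no; contradiction)

variable
  A : Set
  j m n : ℕ

-- Vectors with appended or updated entries

lookup-∷ʳ-inject₁ : (xs : Vec A n) (x : A) (i : Fin n) → lookup (xs ∷ʳ x) (inject₁ i) ≡ lookup xs i
lookup-∷ʳ-inject₁ (y ∷ xs) x zero    = refl
lookup-∷ʳ-inject₁ (y ∷ xs) x (suc i) = lookup-∷ʳ-inject₁ xs x i

lookup-∷ʳ-fromℕ : (xs : Vec A n) (x : A) → lookup (xs ∷ʳ x) (fromℕ n) ≡ x
lookup-∷ʳ-fromℕ []       x = refl
lookup-∷ʳ-fromℕ (y ∷ xs) x = lookup-∷ʳ-fromℕ xs x

lookup-ext : {xs ys : Vec A n} → (∀ i → lookup xs i ≡ lookup ys i) → xs ≡ ys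
lookup-ext {xs = xs} {ys} eq =
  trans (sym (tabulate∘lookup xs)) (trans (tabulate-cong eq) (tabulate∘lookup ys))

[]≔-same : (xs : Vec A n) (i : Fin n) {x : A} → lookup xs i ≡ x → xs [ i ]≔ x ≡ xs
[]≔-same xs i refl = []≔-lookup xs i

-- Writing the common old value `x` back at `i` undoes both updates.
[]≔-cancel : (xs ys : Vec A n) (i : Fin n) {x y : A} → lookup xs i ≡ x → lookup ys i ≡ x →
             xs [ i ]≔ y ≡ ys [ i ]≔ y → xs ≡ ys
[]≔-cancel xs ys i {x} xᵢ yᵢ eq = begin
  xs                       ≡⟨ []≔-same xs i xᵢ ⟨
  xs [ i ]≔ x              ≡⟨ []≔-idempotent xs i ⟨
  (xs [ i ]≔ _) [ i ]≔ x   ≡⟨ cong (_[ i ]≔ x) eq ⟩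
  (ys [ i ]≔ _) [ i ]≔ x   ≡⟨ []≔-idempotent ys i ⟩
  ys [ i ]≔ x              ≡⟨ []≔-same ys i yᵢ ⟩
  ys                       ∎
  where open ≡-Reasoning

cleared : (xs : Vec Bool n) (p i : Fin n) → lookup (xs [ p ]≔ false) i ≡ true → i ≢ p × lookup xs i ≡ true
cleared xs p i eq with i Fin.≟ p
... | yes refl with () ← trans (sym eq) (lookup∘update i xs false)
... | no i≢p = i≢p , trans (sym (lookup∘update′ i≢p xs false)) eq

-- Histories

-- 'same' is for a root with label set {1}, 'next' for a root with label set {1,2}.
data Offset : ℕ → ℕ → Set where
  same : Offset j j
  next : Offset j (suc j)

Offset-suc : Offset j m → Offset (suc j) (suc m)
Offset-suc same = same
Offset-suc next = next

-- In History j m n, j is the number of nodes of the coloured tree, and m and n are the numbers of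
-- labels and of nodes of the multilabelled tree. The root has received all its labels at the start,
-- so 'extensible' marks the unilabelled leaves other than the root.
data History : ℕ → ℕ → ℕ → Set
extensible : History j m n → Vec Bool n

data History where
  start  : Offset 1 m → History 1 m 1
  attach : History j m n → Fin n → History (suc j) (suc m) (suc n)
  extend : (h : History j m n) (p : Fin n) → lookup (extensible h) p ≡ true → History (suc j) (suc m) n

extensible (start _)      = false ∷ []
extensible (attach h p)   = (extensible h [ p ]≔ false) ∷ʳ true
extensible (extend h p _) = extensible h [ p ]≔ false

offset : History j m n → Offset j m
offset (start o)      = o
offset (attach h _)   = Offset-suc (offset h)
offset (extend h _ _) = Offset-suc (offset h)

-- Out-degrees

inject₁² : Fin n × Fin n → Fin (suc n) × Fin (suc n)
inject₁² e = inject₁ (proj₁ e) , inject₁ (proj₂ e)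

count-inject₁ : (i : Fin n) (es : List (Fin n × Fin n)) →
  length (filter (λ e → proj₁ e Fin.≟ inject₁ i) (List.map inject₁² es)) ≡
  length (filter (λ e → proj₁ e Fin.≟ i) es)
count-inject₁ i [] = refl
count-inject₁ i (e ∷ es) with proj₁ e Fin.≟ i
... | yes refl = trans (cong length (filter-accept (λ e → proj₁ e Fin.≟ inject₁ i) refl))
                       (cong suc (count-inject₁ i es))
... | no e≢i   = trans (cong length (filter-reject (λ e → proj₁ e Fin.≟ inject₁ i) (e≢i ∘ inject₁-injective)))
                       (count-inject₁ i es)

count-fromℕ : (es : List (Fin n × Fin n)) →
  length (filter (λ e → proj₁ e Fin.≟ fromℕ n) (List.map inject₁² es)) ≡ 0
count-fromℕ [] = refl
count-fromℕ {n} (e ∷ es) =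
  trans (cong length (filter-reject (λ e → proj₁ e Fin.≟ fromℕ n) {x = inject₁² e} {xs = List.map inject₁² es}
    (fromℕ≢inject₁ ∘ sym))) (count-fromℕ es)

outdeg-parent : (t : Parents n) (p : Fin n) → outdeg (t ▷ p) (inject₁ p) ≡ suc (outdeg t p)
outdeg-parent t p =
  trans (cong length (filter-accept (λ e → proj₁ e Fin.≟ inject₁ p) refl)) (cong suc (count-inject₁ p (edges t)))

outdeg-other : (t : Parents n) {p i : Fin n} → i ≢ p → outdeg (t ▷ p) (inject₁ i) ≡ outdeg t i
outdeg-other t {p} {i} i≢p =
  trans (cong length (filter-reject (λ e → proj₁ e Fin.≟ inject₁ i) (i≢p ∘ sym ∘ inject₁-injective)))
        (count-inject₁ i (edges t))

outdeg-new : (t : Parents n) (p : Fin n) → outdeg (t ▷ p) (fromℕ n) ≡ 0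
outdeg-new {n} t p =
  trans (cong length (filter-reject (λ e → proj₁ e Fin.≟ fromℕ n) {x = inject₁ p , fromℕ n}
    {xs = List.map inject₁² (edges t)} (fromℕ≢inject₁ ∘ sym))) (count-fromℕ (edges t))

outdeg-mono : (t : Parents n) (p i : Fin n) → outdeg t i ≤ outdeg (t ▷ p) (inject₁ i)
outdeg-mono t p i with i Fin.≟ p
... | yes refl = ℕ.≤-trans (ℕ.n≤1+n _) (ℕ.≤-reflexive (sym (outdeg-parent t p)))
... | no i≢p   = ℕ.≤-reflexive (sym (outdeg-other t i≢p))

-- Admissible colourings

Allowed-mono : ∀ {d e c} → d ≤ e → Allowed d c → Allowed e c
Allowed-mono d≤e white     = white
Allowed-mono d≤e (black l) = black (ℕ.≤-trans l d≤e)

Allowed-leaf : ∀ {c} → Allowed 0 c → c ≡ false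
Allowed-leaf white      = refl
Allowed-leaf (black ())

Allowed-irrelevant : ∀ {d c} (a b : Allowed d c) → a ≡ b
Allowed-irrelevant white     white     = refl
Allowed-irrelevant (black k) (black l) = cong black (≤-irrelevant k l)

-- Index form of `colourOK`, stated with `outdeg` instead of its tabulation to allow case analysis
-- on the last node.
AllAllowed : Parents n → Vec Bool n → Set
AllAllowed t c = ∀ i → Allowed (outdeg t i) (lookup c i)

Pointwise⇒AllAllowed : (t : Parents n) (c : Vec Bool n) → Pointwise Allowed (outdegrees t) c → AllAllowed t c
Pointwise⇒AllAllowed t c ok i =
  subst (λ d → Allowed d (lookup c i)) (lookup∘tabulate (outdeg t) i) (Pointwise.lookup ok i)

AllAllowed⇒Pointwise : (t : Parents n) (c : Vec Bool n) → AllAllowed t c → Pointwise Allowed (outdegrees t) c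
AllAllowed⇒Pointwise t c ok = extensional⇒inductive
  (ext λ i → subst (λ d → Allowed d (lookup c i)) (sym (lookup∘tabulate (outdeg t) i)) (ok i))

Pointwise-irrelevant : {ds : Vec ℕ n} {c : Vec Bool n} (a b : Pointwise Allowed ds c) → a ≡ b
Pointwise-irrelevant Pointwise.[]       Pointwise.[]       = refl
Pointwise-irrelevant (x Pointwise.∷ xs) (y Pointwise.∷ ys) =
  cong₂ Pointwise._∷_ (Allowed-irrelevant x y) (Pointwise-irrelevant xs ys)

QHat-≡ : {q r : QHat j} → QHat.tree q ≡ QHat.tree r → QHat.colour q ≡ QHat.colour r → q ≡ r
QHat-≡ {q = qtree t c ok} {qtree _ _ ok′} refl refl = cong (qtree t c) (Pointwise-irrelevant ok ok′)

-- The coloured tree of a history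


-- Every step adds a white leaf to the coloured tree. The node `p` acted on moves there, which fits
-- its no longer being extensible; all others keep their sites.
moved : Vec (Fin j) n → Fin n → Vec (Fin (suc j)) n
moved {j} s p = Vec.map inject₁ s [ p ]≔ fromℕ j

-- 'site h' enumerates the white nodes of the coloured tree by the nodes of the multilabelled tree.
sites : History j m n → Vec (Fin j) n
site  : History j m n → Fin n → Fin j

sites (start _)      = zero ∷ []
-- The site vacated by `p` stays white and has gained a child, so it goes to the new, extensible
-- node.
sites (attach h p)   = moved (sites h) p ∷ʳ inject₁ (site h p)
-- The site vacated by `p` turns black and drops out of the enumeration.
sites (extend h p _) = moved (sites h) p

site h = lookup (sites h)

qParents : History j m n → Parents j
qParents (start _)      = root
qParents (attach h p)   = qParents h ▷ site h p
qParents (extend h p _) = qParents h ▷ site h p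

qColour : History j m n → Vec Bool j
qColour (start _)      = false ∷ []
qColour (attach h p)   = qColour h ∷ʳ false
qColour (extend h p _) = (qColour h [ site h p ]≔ true) ∷ʳ false

moved-at : (s : Vec (Fin j) n) (p : Fin n) → lookup (moved s p) p ≡ fromℕ j
moved-at s p = lookup∘update p (Vec.map inject₁ s) _

moved-off : (s : Vec (Fin j) n) {p i : Fin n} → i ≢ p → lookup (moved s p) i ≡ inject₁ (lookup s i)
moved-off s {i = i} i≢p = trans (lookup∘update′ i≢p (Vec.map inject₁ s) _) (lookup-map i inject₁ s)

Injective : Vec A n → Set
Injective xs = ∀ {i k} → lookup xs i ≡ lookup xs k → i ≡ k

moved-injective : (s : Vec (Fin j) n) (p : Fin n) → Injective s → Injective (moved s p)
moved-injective s p inj {i} {k} eq with i Fin.≟ p | k Fin.≟ p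
... | yes refl | yes refl = refl
... | yes refl | no k≢p   = contradiction (trans (sym (moved-at s p)) (trans eq (moved-off s k≢p))) fromℕ≢inject₁
... | no i≢p   | yes refl = contradiction (trans (sym (moved-at s p)) (trans (sym eq) (moved-off s i≢p))) fromℕ≢inject₁
... | no i≢p   | no k≢p   = inj (inject₁-injective (trans (sym (moved-off s i≢p)) (trans eq (moved-off s k≢p))))

old-site-not-moved : (s : Vec (Fin j) n) (p : Fin n) → Injective s → ∀ k → lookup (moved s p) k ≢ inject₁ (lookup s p)
old-site-not-moved s p inj k eq with k Fin.≟ p
... | yes refl = fromℕ≢inject₁ (trans (sym (moved-at s p)) eq)
... | no k≢p   = k≢p (inj (inject₁-injective (trans (sym (moved-off s k≢p)) eq)))

∷ʳ-Injective : (xs : Vec A n) {x : A} → Injective xs → (∀ k → lookup xs k ≢ x) → Injective (xs ∷ʳ x)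
∷ʳ-Injective xs {x} inj fresh {i} {k} eq with view i | view k
... | ‵fromℕ     | ‵fromℕ     = refl
... | ‵fromℕ     | ‵inject₁ k = contradiction
  (trans (sym (lookup-∷ʳ-inject₁ xs x k)) (trans (sym eq) (lookup-∷ʳ-fromℕ xs x))) (fresh k)
... | ‵inject₁ i | ‵fromℕ     = contradiction
  (trans (sym (lookup-∷ʳ-inject₁ xs x i)) (trans eq (lookup-∷ʳ-fromℕ xs x))) (fresh i)
... | ‵inject₁ i | ‵inject₁ k =
  cong inject₁ (inj (trans (sym (lookup-∷ʳ-inject₁ xs x i)) (trans eq (lookup-∷ʳ-inject₁ xs x k))))

-- With `site-white` and `white-site` this makes `site h` a bijection onto the white nodes.
site-injective : (h : History j m n) → Injective (sites h)
site-injective (start _) {zero} {zero} _ = refl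
site-injective (attach h p)   = ∷ʳ-Injective (moved (sites h) p) (moved-injective (sites h) p (site-injective h))
                                  (old-site-not-moved (sites h) p (site-injective h))
site-injective (extend h p _) = moved-injective (sites h) p (site-injective h)

site-white : (h : History j m n) (i : Fin n) → lookup (qColour h) (site h i) ≡ false
site-white (start _) zero = refl
site-white (attach h p) i with view i
... | ‵fromℕ rewrite lookup-∷ʳ-fromℕ (moved (sites h) p) (inject₁ (site h p))
  = trans (lookup-∷ʳ-inject₁ (qColour h) false (site h p)) (site-white h p)
... | ‵inject₁ i rewrite lookup-∷ʳ-inject₁ (moved (sites h) p) (inject₁ (site h p)) i with i Fin.≟ p
...   | yes refl rewrite moved-at (sites h) p = lookup-∷ʳ-fromℕ (qColour h) false
...   | no i≢p rewrite moved-off (sites h) i≢p =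
        trans (lookup-∷ʳ-inject₁ (qColour h) false (site h i)) (site-white h i)
site-white (extend h p _) i with i Fin.≟ p
... | yes refl rewrite moved-at (sites h) p = lookup-∷ʳ-fromℕ (qColour h [ site h p ]≔ true) false
... | no i≢p rewrite moved-off (sites h) i≢p = begin
  lookup ((qColour h [ site h p ]≔ true) ∷ʳ false) (inject₁ (site h i))
    ≡⟨ lookup-∷ʳ-inject₁ (qColour h [ site h p ]≔ true) false (site h i) ⟩
  lookup (qColour h [ site h p ]≔ true) (site h i)
    -- Injectivity keeps the site of `i` apart from the one that turned black.
    ≡⟨ lookup∘update′ (i≢p ∘ site-injective h) (qColour h) true ⟩
  lookup (qColour h) (site h i)
    ≡⟨ site-white h i ⟩
  false ∎
  where open ≡-Reasoning

white-site : (h : History j m n) (q : Fin j) → lookup (qColour h) q ≡ false → ∃ λ i → site h i ≡ q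
white-site (start _) zero _ = zero , refl
white-site (attach h p) q w with view q
... | ‵fromℕ = inject₁ p ,
  trans (lookup-∷ʳ-inject₁ (moved (sites h) p) (inject₁ (site h p)) p) (moved-at (sites h) p)
... | ‵inject₁ q with white-site h q (trans (sym (lookup-∷ʳ-inject₁ (qColour h) false q)) w)
...   | i , refl with i Fin.≟ p
-- The site vacated by `p` is now held by the new node.
...     | yes refl = fromℕ _ , lookup-∷ʳ-fromℕ (moved (sites h) p) (inject₁ (site h p))
...     | no i≢p   = inject₁ i ,
          trans (lookup-∷ʳ-inject₁ (moved (sites h) p) (inject₁ (site h p)) i) (moved-off (sites h) i≢p)
white-site (extend h p _) q w with view q
... | ‵fromℕ = p , moved-at (sites h) p
... | ‵inject₁ q with q Fin.≟ site h p
...   | yes refl with () ← trans (sym w) (trans (lookup-∷ʳ-inject₁ (qColour h [ q ]≔ true) false q)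
                                               (lookup∘update q (qColour h) true))
...   | no q≢ with white-site h q (trans (sym (lookup∘update′ q≢ (qColour h) true))
                                  (trans (sym (lookup-∷ʳ-inject₁ (qColour h [ site h p ]≔ true) false q)) w))
...     | i , refl = i , moved-off (sites h) (q≢ ∘ cong (site h))

-- A new node takes over a site that has just gained a child, while at all other nodes still
-- extensible neither flag nor out-degree changes.
extensible⇒internal : (h : History j m n) (i : Fin n) → lookup (extensible h) i ≡ true →
                      1 ≤ outdeg (qParents h) (site h i)
extensible⇒internal (start _) zero ()
extensible⇒internal (attach h p) i e with view i
... | ‵fromℕ rewrite lookup-∷ʳ-fromℕ (moved (sites h) p) (inject₁ (site h p)) | outdeg-parent (qParents h) (site h p)
  = s≤s z≤n
... | ‵inject₁ i rewrite lookup-∷ʳ-inject₁ (moved (sites h) p) (inject₁ (site h p)) i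
                       | lookup-∷ʳ-inject₁ (extensible h [ p ]≔ false) true i with cleared (extensible h) p i e
...   | i≢p , e′ rewrite moved-off (sites h) i≢p | outdeg-other (qParents h) (i≢p ∘ site-injective h)
  = extensible⇒internal h i e′
extensible⇒internal (extend h p _) i e with cleared (extensible h) p i e
... | i≢p , e′ rewrite moved-off (sites h) i≢p | outdeg-other (qParents h) (i≢p ∘ site-injective h)
  = extensible⇒internal h i e′

-- The node `p` acted on is ruled out because its new site is a leaf; every other old node keeps its
-- flag and out-degree.
internal⇒extensible : (h : History j m n) (i : Fin n) → 1 ≤ outdeg (qParents h) (site h i) →
                      lookup (extensible h) i ≡ true
internal⇒extensible (start _) zero ()
internal⇒extensible (attach h p) i d with view i
... | ‵fromℕ = lookup-∷ʳ-fromℕ (extensible h [ p ]≔ false) true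
... | ‵inject₁ i rewrite lookup-∷ʳ-inject₁ (moved (sites h) p) (inject₁ (site h p)) i
                       | lookup-∷ʳ-inject₁ (extensible h [ p ]≔ false) true i with i Fin.≟ p
...   | yes refl rewrite moved-at (sites h) p | outdeg-new (qParents h) (site h p) with () ← d
...   | no i≢p rewrite moved-off (sites h) i≢p | outdeg-other (qParents h) (i≢p ∘ site-injective h)
  = trans (lookup∘update′ i≢p (extensible h) false) (internal⇒extensible h i d)
internal⇒extensible (extend h p _) i d with i Fin.≟ p
... | yes refl rewrite moved-at (sites h) p | outdeg-new (qParents h) (site h p) with () ← d
... | no i≢p rewrite moved-off (sites h) i≢p | outdeg-other (qParents h) (i≢p ∘ site-injective h)
  = trans (lookup∘update′ i≢p (extensible h) false) (internal⇒extensible h i d)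

∷ʳ-allowed : (t : Parents n) (p : Fin n) (c : Vec Bool n) →
             (∀ i → Allowed (outdeg (t ▷ p) (inject₁ i)) (lookup c i)) → AllAllowed (t ▷ p) (c ∷ʳ false)
∷ʳ-allowed t p c ok i with view i
... | ‵fromℕ rewrite lookup-∷ʳ-fromℕ c false = white
... | ‵inject₁ i rewrite lookup-∷ʳ-inject₁ c false i = ok i

qColour-allowed : (h : History j m n) → AllAllowed (qParents h) (qColour h)
qColour-allowed (start _) zero = white
qColour-allowed (attach h p) = ∷ʳ-allowed (qParents h) (site h p) (qColour h)
  λ i → Allowed-mono (outdeg-mono (qParents h) (site h p) i) (qColour-allowed h i)
qColour-allowed (extend h p e) = ∷ʳ-allowed (qParents h) (site h p) (qColour h [ site h p ]≔ true) ok
  where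
  ok : ∀ i → Allowed (outdeg (qParents h ▷ site h p) (inject₁ i)) (lookup (qColour h [ site h p ]≔ true) i)
  ok i with i Fin.≟ site h p
  -- The site of an extensible node already had a child and now gains another, so it may be black.
  ... | yes refl rewrite lookup∘update i (qColour h) true | outdeg-parent (qParents h) (site h p)
    = black (s≤s (extensible⇒internal h p e))
  ... | no i≢ rewrite lookup∘update′ i≢ (qColour h) true
    = Allowed-mono (outdeg-mono (qParents h) (site h p) i) (qColour-allowed h i)

toQHat : History j m n → QHat j
toQHat h = qtree (qParents h) (qColour h) (AllAllowed⇒Pointwise (qParents h) (qColour h) (qColour-allowed h))

-- Recovering a history from a coloured tree

Coloured : (m : ℕ) → Parents j → Vec Bool j → Set
Coloured {j} m t c = ∃ λ n → Σ (History j m n) λ h → qParents h ≡ t × qColour h ≡ c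

-- The colour `b` of the last node's parent decides the last step: white means `attach`, black means
-- `extend`. The history `h` belongs to the tree without the last node and with `p` made white.
coloured-step : (t : Parents j) (p : Fin j) (c : Vec Bool j) (b : Bool) → lookup c p ≡ b →
                Allowed (outdeg (t ▷ p) (inject₁ p)) b →
                (h : History j m n) → qParents h ≡ t → qColour h ≡ c [ p ]≔ false →
                Coloured (suc m) (t ▷ p) (c ∷ʳ false)
-- Once recoloured, `p` is white and hence the site of some node `i`.
coloured-step t p c b cₚ ok h refl qc
  with white-site h p (trans (cong (λ v → lookup v p) qc) (lookup∘update p c false))
coloured-step t p c false cₚ ok h refl qc | i , refl =
  _ , attach h i , refl , cong (_∷ʳ false) (trans qc ([]≔-same c p cₚ))
coloured-step t p c true cₚ (black 2≤d) h refl qc | i , refl =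
  _ , extend h i internal , refl ,
  cong (_∷ʳ false) (trans (cong (_[ p ]≔ true) qc) (trans ([]≔-idempotent c p) ([]≔-same c p cₚ)))
  where
  internal : lookup (extensible h) i ≡ true
  -- Out-degree at least 2 with the last node present leaves at least 1 without it.
  internal = internal⇒extensible h i (s≤s⁻¹ (subst (2 ≤_) (outdeg-parent t p) 2≤d))

-- Only the out-degree of `p` drops when the last node goes, and `p` becomes white.
uncoloured-allowed : (t : Parents n) (p : Fin n) (c : Vec Bool n) {b : Bool} →
                     AllAllowed (t ▷ p) (c ∷ʳ b) → AllAllowed t (c [ p ]≔ false)
uncoloured-allowed t p c {b} ok i with i Fin.≟ p
... | yes refl rewrite lookup∘update i c false = white
... | no i≢p   rewrite lookup∘update′ i≢p c false =
  subst₂ Allowed (outdeg-other t i≢p) (lookup-∷ʳ-inject₁ c b i) (ok (inject₁ i))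

coloured : (t : Parents j) (c : Vec Bool j) → AllAllowed t c → Offset j m → Coloured m t c
coloured root (b ∷ []) ok o = 1 , start o , refl , cong (_∷ []) (sym (Allowed-leaf (ok zero)))
coloured {suc j} (t ▷ p) c ok o with initLast c
... | c , b , refl
  -- The last node is a leaf, so it can only be white.
  with refl ← Allowed-leaf (subst₂ Allowed (outdeg-new t p) (lookup-∷ʳ-fromℕ c b) (ok (fromℕ j)))
  -- Splitting on `o` exposes `m` as a successor, so the recursive call can use one label fewer and
  -- the same offset.
  with lookup-∷ʳ-inject₁ c false p | o
... | cₚ | same = let n , h , t≡ , c≡ = coloured t (c [ p ]≔ false) (uncoloured-allowed t p c ok) same in
  coloured-step t p c _ (sym cₚ) (ok (inject₁ p)) h t≡ c≡
... | cₚ | next = let n , h , t≡ , c≡ = coloured t (c [ p ]≔ false) (uncoloured-allowed t p c ok) next in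
  coloured-step t p c _ (sym cₚ) (ok (inject₁ p)) h t≡ c≡

▷-injective : {t u : Parents n} {p q : Fin n} → t ▷ p ≡ u ▷ q → t ≡ u × p ≡ q
▷-injective refl = refl , refl

Offset-irrelevant : (o o′ : Offset 1 m) → o ≡ o′
Offset-irrelevant same same = refl
Offset-irrelevant next next = refl

extend-cong : (h : History j m n) {p q : Fin n} {e : lookup (extensible h) p ≡ true} {e′ : lookup (extensible h) q ≡ true} →
              p ≡ q → extend h p e ≡ extend h q e′
extend-cong h {p} refl = cong (extend h p) (uip _ _)

-- Sites are white, and an extension paints the site black, so the parent's colour separates the two
-- kinds of step.
attach-colour : ∀ (h : History j m n) (p : Fin n) {n′} (h′ : History j m n′) (p′ : Fin n′) →
  site h p ≡ site h′ p′ → qColour h ≢ qColour h′ [ site h′ p′ ]≔ true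
attach-colour h p h′ p′ s≡ c≡ with () ← trans (sym (site-white h p))
  (trans (cong₂ lookup c≡ s≡) (lookup∘update (site h′ p′) (qColour h′) true))

-- The last node's parent and that parent's colour determine the last step; undoing it leaves the
-- coloured tree of the earlier history. Pairs are compared because `n` is not given by the coloured
-- tree beforehand.
q-injective : ∀ {n n′} (h : History j m n) (h′ : History j m n′) →
              qParents h ≡ qParents h′ → qColour h ≡ qColour h′ → _≡_ {A = ∃ (History j m)} (n , h) (n′ , h′)
q-injective (start o) (start o′) _ _ = cong (λ o → 1 , start o) (Offset-irrelevant o o′)
q-injective (attach h p) (attach h′ p′) t≡ c≡
  with t≡′ , s≡ ← ▷-injective t≡
  with refl ← q-injective h h′ t≡′ (proj₁ (∷ʳ-injective (qColour h) (qColour h′) c≡))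
  with refl ← site-injective h s≡ = refl
q-injective (extend h p e) (extend h′ p′ e′) t≡ c≡
  with t≡′ , s≡ ← ▷-injective t≡
  -- Both sites were white before the step, so the black update can be cancelled.
  with refl ← q-injective h h′ t≡′ ([]≔-cancel (qColour h) (qColour h′) (site h p) (site-white h p)
                (trans (cong (lookup (qColour h′)) s≡) (site-white h′ p′))
                (trans (proj₁ (∷ʳ-injective _ _ c≡)) (cong (qColour h′ [_]≔ true) (sym s≡))))
  = cong (_ ,_) (extend-cong h (site-injective h s≡))
q-injective (attach h p) (extend h′ p′ e′) t≡ c≡ =
  contradiction (proj₁ (∷ʳ-injective _ _ c≡)) (attach-colour h p h′ p′ (proj₂ (▷-injective t≡)))
q-injective (extend h p e) (attach h′ p′) t≡ c≡ =
  contradiction (proj₁ (∷ʳ-injective _ _ (sym c≡))) (attach-colour h′ p′ h p (sym (proj₂ (▷-injective t≡))))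
q-injective (start _) (attach h _)   ()
q-injective (start _) (extend h _ _) ()
q-injective (attach h _) (start _)   ()
q-injective (extend h _ _) (start _) ()

-- Label sets

_∈ᴸ_ : Fin m → LabelSet m → Set
ℓ ∈ᴸ one a     = ℓ ≡ a
ℓ ∈ᴸ two a b _ = ℓ ≡ a ⊎ ℓ ≡ b

one-injective : {a b : Fin m} → one a ≡ one b → a ≡ b
one-injective refl = refl

two-injective : {a b c d : Fin m} {a<b : toℕ a < toℕ b} {c<d : toℕ c < toℕ d} →
                two a b a<b ≡ two c d c<d → a ≡ c × b ≡ d
two-injective refl = refl , refl

two-cong : {a b c d : Fin m} {a<b : toℕ a < toℕ b} {c<d : toℕ c < toℕ d} →
           a ≡ c → b ≡ d → two a b a<b ≡ two c d c<d
two-cong {a = a} {b} refl refl = cong (two a b) (<-irrelevant _ _)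

minL<m : (A : LabelSet m) → minL A < m
minL<m (one a)     = toℕ<n a
minL<m (two a _ _) = toℕ<n a

maxL<m : (A : LabelSet m) → maxL A < m
maxL<m (one a)     = toℕ<n a
maxL<m (two _ b _) = toℕ<n b

inject-< : {a b : Fin m} → toℕ a < toℕ b → toℕ (inject₁ a) < toℕ (inject₁ b)
inject-< {a = a} {b} = subst₂ _<_ (sym (toℕ-inject₁ a)) (sym (toℕ-inject₁ b))

inject-<-fromℕ : (a : Fin m) → toℕ (inject₁ a) < toℕ (fromℕ m)
inject-<-fromℕ {m} a = subst₂ _<_ (sym (toℕ-inject₁ a)) (sym (toℕ-fromℕ m)) (toℕ<n a)

injectL : LabelSet m → LabelSet (suc m)
injectL (one a)       = one (inject₁ a)
injectL (two a b a<b) = two (inject₁ a) (inject₁ b) (inject-< a<b)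

-- The value on two-element sets is junk.
addMax : LabelSet m → LabelSet (suc m)
addMax {m} (one a)       = two (inject₁ a) (fromℕ m) (inject-<-fromℕ a)
addMax     (two a b a<b) = injectL (two a b a<b)

injectL-injective : {A B : LabelSet m} → injectL A ≡ injectL B → A ≡ B
injectL-injective {A = one a} {one b} eq = cong one (inject₁-injective (one-injective eq))
injectL-injective {A = two a b _} {two c d _} eq =
  two-cong (inject₁-injective (proj₁ (two-injective eq))) (inject₁-injective (proj₂ (two-injective eq)))

minL-injectL : (A : LabelSet m) → minL (injectL A) ≡ minL A
minL-injectL (one a)     = toℕ-inject₁ a
minL-injectL (two a _ _) = toℕ-inject₁ a

maxL-injectL : (A : LabelSet m) → maxL (injectL A) ≡ maxL A
maxL-injectL (one a)     = toℕ-inject₁ a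
maxL-injectL (two _ b _) = toℕ-inject₁ b

∈-injectL⁺ : {ℓ : Fin m} (A : LabelSet m) → ℓ ∈ᴸ A → inject₁ ℓ ∈ᴸ injectL A
∈-injectL⁺ (one _)     refl        = refl
∈-injectL⁺ (two _ _ _) (inj₁ refl) = inj₁ refl
∈-injectL⁺ (two _ _ _) (inj₂ refl) = inj₂ refl

∈-injectL⁻ : {ℓ : Fin m} (A : LabelSet m) → inject₁ ℓ ∈ᴸ injectL A → ℓ ∈ᴸ A
∈-injectL⁻ (one _)     eq        = inject₁-injective eq
∈-injectL⁻ (two _ _ _) (inj₁ eq) = inj₁ (inject₁-injective eq)
∈-injectL⁻ (two _ _ _) (inj₂ eq) = inj₂ (inject₁-injective eq)

fromℕ∉injectL : (A : LabelSet m) → ¬ (fromℕ m ∈ᴸ injectL A)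
fromℕ∉injectL (one _)     eq        = fromℕ≢inject₁ eq
fromℕ∉injectL (two _ _ _) (inj₁ eq) = fromℕ≢inject₁ eq
fromℕ∉injectL (two _ _ _) (inj₂ eq) = fromℕ≢inject₁ eq

≢fromℕ⇒inject₁ : (a : Fin (suc m)) → fromℕ m ≢ a → ∃ λ b → a ≡ inject₁ b
≢fromℕ⇒inject₁ a a≢ with view a
... | ‵fromℕ     = contradiction refl a≢
... | ‵inject₁ b = b , refl

fromℕ∉⇒injectL : (A : LabelSet (suc m)) → ¬ (fromℕ m ∈ᴸ A) → ∃ λ B → A ≡ injectL B
fromℕ∉⇒injectL (one a) ∉ with b , refl ← ≢fromℕ⇒inject₁ a ∉ = one b , refl
fromℕ∉⇒injectL (two a b a<b) ∉
  with c , refl ← ≢fromℕ⇒inject₁ a (∉ ∘ inj₁) | d , refl ← ≢fromℕ⇒inject₁ b (∉ ∘ inj₂)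
  = two c d (subst₂ _<_ (toℕ-inject₁ c) (toℕ-inject₁ d) a<b) , two-cong refl refl

-- DropMax A B: B is what remains of A without the label m (which must not be all of A).
data DropMax {m : ℕ} (A : LabelSet (suc m)) : LabelSet m → Set where
  keep : ∀ {B} → A ≡ injectL B → DropMax A B
  cut  : ∀ {a} → A ≡ addMax (one a) → DropMax A (one a)

-- `keep` and `cut` exclude each other: only a set that is cut contains `fromℕ m`.
DropMax-deterministic : {A : LabelSet (suc m)} {B C : LabelSet m} → DropMax A B → DropMax A C → B ≡ C
DropMax-deterministic (keep p) (keep q) = injectL-injective (trans (sym p) q)
DropMax-deterministic (keep {B} p) (cut q) =
  contradiction (subst (fromℕ _ ∈ᴸ_) (trans (sym q) p) (inj₂ refl)) (fromℕ∉injectL B)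
DropMax-deterministic (cut p) (keep {B} q) =
  contradiction (subst (fromℕ _ ∈ᴸ_) (trans (sym p) q) (inj₂ refl)) (fromℕ∉injectL B)
DropMax-deterministic (cut p) (cut q) = cong one (inject₁-injective (proj₁ (two-injective (trans (sym p) q))))

DropMax-minL : {A : LabelSet (suc m)} {B : LabelSet m} → DropMax A B → minL A ≡ minL B
DropMax-minL {B = B} (keep refl)    = minL-injectL B
DropMax-minL         (cut {a} refl) = toℕ-inject₁ a

-- An inequality is enough, since maxima are compared only as the lower side of an edge condition.
DropMax-maxL : {A : LabelSet (suc m)} {B : LabelSet m} → DropMax A B → maxL B ≤ maxL A
DropMax-maxL {B = B} (keep refl)    = ℕ.≤-reflexive (sym (maxL-injectL B))
DropMax-maxL         (cut {a} refl) = subst (_≤ toℕ (fromℕ _)) (toℕ-inject₁ a) (ℕ.<⇒≤ (inject-<-fromℕ a))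

DropMax-∈⁺ : {A : LabelSet (suc m)} {B : LabelSet m} {ℓ : Fin m} → DropMax A B → ℓ ∈ᴸ B → inject₁ ℓ ∈ᴸ A
DropMax-∈⁺ {B = B} (keep refl) ℓ∈   = ∈-injectL⁺ B ℓ∈
DropMax-∈⁺         (cut refl)  refl = inj₁ refl

DropMax-∈⁻ : {A : LabelSet (suc m)} {B : LabelSet m} {ℓ : Fin m} → DropMax A B → inject₁ ℓ ∈ᴸ A → ℓ ∈ᴸ B
DropMax-∈⁻ {B = B} (keep refl) ℓ∈        = ∈-injectL⁻ B ℓ∈
DropMax-∈⁻         (cut refl)  (inj₁ eq) = inject₁-injective eq
DropMax-∈⁻         (cut refl)  (inj₂ eq) = contradiction (sym eq) fromℕ≢inject₁

-- Multilabelled increasing trees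

-- Membership in `edges t` as an inductive family, so that matching separates the edge to the last
-- node from the older ones.
data Edge : Parents n → Fin n → Fin n → Set where
  new : {t : Parents n} {p : Fin n} → Edge (t ▷ p) (inject₁ p) (fromℕ n)
  old : {t : Parents n} {p i k : Fin n} → Edge t i k → Edge (t ▷ p) (inject₁ i) (inject₁ k)

Edge⇒∈ : {t : Parents n} {i k : Fin n} → Edge t i k → (i , k) ∈ edges t
Edge⇒∈ new     = here refl
Edge⇒∈ (old e) = there (∈-map⁺ inject₁² (Edge⇒∈ e))

All-edges : (t : Parents n) {P : Fin n × Fin n → Set} → (∀ {i k} → Edge t i k → P (i , k)) → LAll.All P (edges t)
All-edges root    f = LAll.[]
All-edges (t ▷ p) f = f new LAll.∷ LAllₚ.map⁺ (All-edges t (f ∘ old))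

Leaf : Parents n → Fin n → Set
Leaf t p = ∀ {k} → ¬ Edge t p k

UniqueNode : Fin m → Vec (LabelSet m) n → Set
UniqueNode ℓ L = ∃ λ i → ℓ ∈ᴸ lookup L i × (∀ k → ℓ ∈ᴸ lookup L k → i ≡ k)

-- The conditions of `THat` in index form, with unique nodes in place of occurrence counts.
record Valid (t : Parents n) (L : Vec (LabelSet m) n) : Set where
  field
    sorted     : ∀ {i k} → i Fin.< k → minL (lookup L i) < minL (lookup L k)
    node       : (ℓ : Fin m) → UniqueNode ℓ L
    increasing : ∀ {i k} → Edge t i k → maxL (lookup L i) < minL (lookup L k)

open Valid

-- Occurrence counts and unique nodes

_∈ᴸ?_ : (ℓ : Fin m) (A : LabelSet m) → (ℓ ∈ᴸ A × occ ℓ A ≡ 1) ⊎ (¬ (ℓ ∈ᴸ A) × occ ℓ A ≡ 0)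
ℓ ∈ᴸ? one a with ℓ Fin.≟ a
... | yes ℓ≡a = inj₁ (ℓ≡a , refl)
... | no  ℓ≢a = inj₂ (ℓ≢a , refl)
ℓ ∈ᴸ? two a b a<b with ℓ Fin.≟ a | ℓ Fin.≟ b
... | yes refl | yes refl = contradiction a<b (<-irrefl refl)
... | yes ℓ≡a  | no _     = inj₁ (inj₁ ℓ≡a , refl)
... | no _     | yes ℓ≡b  = inj₁ (inj₂ ℓ≡b , refl)
... | no ℓ≢a   | no ℓ≢b   = inj₂ ((λ { (inj₁ eq) → ℓ≢a eq ; (inj₂ eq) → ℓ≢b eq }) , refl)

occurrences≡0⇒∉ : (ℓ : Fin m) (L : Vec (LabelSet m) n) → occurrences ℓ L ≡ 0 → ∀ i → ¬ (ℓ ∈ᴸ lookup L i)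
occurrences≡0⇒∉ ℓ (A ∷ L) eq i ℓ∈ with ℓ ∈ᴸ? A | i
... | inj₁ (_ , occ≡1) | _ with () ← trans (sym (cong (_+ occurrences ℓ L) occ≡1)) eq
... | inj₂ (ℓ∉ , _) | zero = ℓ∉ ℓ∈
... | inj₂ (_ , occ≡0) | suc i =
  occurrences≡0⇒∉ ℓ L (trans (sym (cong (_+ occurrences ℓ L) occ≡0)) eq) i ℓ∈

∉⇒occurrences≡0 : (ℓ : Fin m) (L : Vec (LabelSet m) n) → (∀ i → ¬ (ℓ ∈ᴸ lookup L i)) → occurrences ℓ L ≡ 0
∉⇒occurrences≡0 ℓ []      ∉ = refl
∉⇒occurrences≡0 ℓ (A ∷ L) ∉ with ℓ ∈ᴸ? A
... | inj₁ (ℓ∈ , _)    = contradiction ℓ∈ (∉ zero)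
... | inj₂ (_ , occ≡0) = cong₂ _+_ occ≡0 (∉⇒occurrences≡0 ℓ L (∉ ∘ suc))

occurrences≡1⇒unique : (ℓ : Fin m) (L : Vec (LabelSet m) n) → occurrences ℓ L ≡ 1 → UniqueNode ℓ L
occurrences≡1⇒unique ℓ (A ∷ L) eq with ℓ ∈ᴸ? A
... | inj₁ (ℓ∈ , occ≡1) = zero , ℓ∈ , λ
  { zero    _   → refl
  ; (suc k) ℓ∈′ → contradiction ℓ∈′
      (occurrences≡0⇒∉ ℓ L (suc-injective (trans (sym (cong (_+ occurrences ℓ L) occ≡1)) eq)) k) }
... | inj₂ (ℓ∉ , occ≡0)
  with i , ℓ∈ , uniq ← occurrences≡1⇒unique ℓ L (trans (sym (cong (_+ occurrences ℓ L) occ≡0)) eq) =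
  suc i , ℓ∈ , λ { zero ℓ∈′ → contradiction ℓ∈′ ℓ∉ ; (suc k) ℓ∈′ → cong suc (uniq k ℓ∈′) }

unique⇒occurrences≡1 : (ℓ : Fin m) (L : Vec (LabelSet m) n) → UniqueNode ℓ L → occurrences ℓ L ≡ 1
unique⇒occurrences≡1 ℓ (A ∷ L) (i , ℓ∈ , uniq) with ℓ ∈ᴸ? A | i
... | inj₁ (ℓ∈A , occ≡1) | _ = cong₂ _+_ occ≡1 (∉⇒occurrences≡0 ℓ L λ k ℓ∈′ → Finₚ.0≢1+n (trans (sym (uniq zero ℓ∈A)) (uniq (suc k) ℓ∈′)))
... | inj₂ (ℓ∉ , _) | zero = contradiction ℓ∈ ℓ∉
... | inj₂ (_ , occ≡0) | suc i = cong₂ _+_ occ≡0 (unique⇒occurrences≡1 ℓ L (i , ℓ∈ , λ k ℓ∈′ → Finₚ.suc-injective (uniq (suc k) ℓ∈′)))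

module _ {R : A → A → Set} where

  AllPairs⇒lookup : (xs : Vec A n) → AllPairs R (toList xs) → ∀ {i k} → i Fin.< k → R (lookup xs i) (lookup xs k)
  AllPairs⇒lookup (x ∷ xs) (x∼ ∷ _) {zero} {suc k} _ = lookup-All xs x∼ k
    where
    lookup-All : ∀ {n} {P : A → Set} (xs : Vec A n) → LAll.All P (toList xs) → ∀ i → P (lookup xs i)
    lookup-All (x ∷ xs) (px LAll.∷ _)   zero    = px
    lookup-All (x ∷ xs) (_  LAll.∷ pxs) (suc i) = lookup-All xs pxs i
  AllPairs⇒lookup (x ∷ xs) (_ ∷ xs∼) {suc i} {suc k} (s≤s i<k) = AllPairs⇒lookup xs xs∼ i<k

  lookup⇒AllPairs : (xs : Vec A n) → (∀ {i k} → i Fin.< k → R (lookup xs i) (lookup xs k)) → AllPairs R (toList xs)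
  lookup⇒AllPairs []       f = []
  lookup⇒AllPairs (x ∷ xs) f = tabulate-All xs (λ i → f {zero} {suc i} (s≤s z≤n)) ∷ lookup⇒AllPairs xs (f ∘ s≤s)
    where
    tabulate-All : ∀ {n} {P : A → Set} (xs : Vec A n) → (∀ i → P (lookup xs i)) → LAll.All P (toList xs)
    tabulate-All []       f = LAll.[]
    tabulate-All (x ∷ xs) f = f zero LAll.∷ tabulate-All xs (f ∘ suc)

THat⇒Valid : (T : THat m) → Valid (THat.tree T) (THat.labels T)
THat⇒Valid T = record
  { sorted     = AllPairs⇒lookup labels (Linked⇒AllPairs <-trans nodesSorted)
  ; node       = λ ℓ → occurrences≡1⇒unique ℓ labels (VAllₚ.tabulate⁻ partition ℓ)
  ; increasing = λ e → LAll.lookup (THat.increasing T) (Edge⇒∈ e)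
  }
  where open THat T

Valid⇒THat : (t : Parents n) (L : Vec (LabelSet m) n) → Valid t L → THat m
Valid⇒THat {n} t L v = ttree n t L
  (AllPairs⇒Linked (lookup⇒AllPairs L (sorted v)))
  (VAllₚ.tabulate⁺ λ ℓ → unique⇒occurrences≡1 ℓ L (node v ℓ))
  (All-edges t (increasing v))

Shape : ℕ → ℕ → Set
Shape m n = Parents n × Vec (LabelSet m) n

shape : THat m → ∃ (Shape m)
shape T = THat.n T , THat.tree T , THat.labels T

-- The three conditions are proof-irrelevant, so the data determine the tree.
shape-injective : {T U : THat m} → shape T ≡ shape U → T ≡ U
shape-injective {T = ttree n t L s p i} {ttree _ _ _ s′ p′ i′} refl
  rewrite Linked.irrelevant <-irrelevant s s′ | VAll.irrelevant uip p p′ | LAll.irrelevant <-irrelevant i i′ = refl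

-- The multilabelled tree of a history

attached : Vec (LabelSet m) n → Vec (LabelSet (suc m)) (suc n)
attached {m} L = Vec.map injectL L ∷ʳ one (fromℕ m)

extended : Vec (LabelSet m) n → Fin n → Vec (LabelSet (suc m)) n
extended L p = Vec.map injectL L [ p ]≔ addMax (lookup L p)

tParents : History j m n → Parents n
tParents (start _)      = root
tParents (attach h p)   = tParents h ▷ p
tParents (extend h p _) = tParents h

tLabels : History j m n → Vec (LabelSet m) n
tLabels (start same)   = one zero ∷ []
tLabels (start next)   = two zero (suc zero) (s≤s z≤n) ∷ []
tLabels (attach h p)   = attached (tLabels h)
tLabels (extend h p _) = extended (tLabels h) p

attached-at : (L : Vec (LabelSet m) n) → lookup (attached L) (fromℕ n) ≡ one (fromℕ m)
attached-at L = lookup-∷ʳ-fromℕ (Vec.map injectL L) _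

attached-off : (L : Vec (LabelSet m) n) (i : Fin n) →
               lookup (attached L) (inject₁ i) ≡ injectL (lookup L i)
attached-off L i = trans (lookup-∷ʳ-inject₁ (Vec.map injectL L) _ i) (lookup-map i injectL L)

extended-at : (L : Vec (LabelSet m) n) (p : Fin n) → lookup (extended L p) p ≡ addMax (lookup L p)
extended-at L p = lookup∘update p (Vec.map injectL L) _

extended-off : (L : Vec (LabelSet m) n) {p i : Fin n} → i ≢ p → lookup (extended L p) i ≡ injectL (lookup L i)
extended-off L {p} {i} i≢p = trans (lookup∘update′ i≢p (Vec.map injectL L) _) (lookup-map i injectL L)

-- Unilabelledness of `p` avoids the junk values of `addMax`: the set at `p` is cut, all others are
-- kept.
extended-drop : (L : Vec (LabelSet m) n) (p : Fin n) {a : Fin m} → lookup L p ≡ one a →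
                ∀ i → DropMax (lookup (extended L p) i) (lookup L i)
extended-drop L p Lₚ i with i Fin.≟ p
... | yes refl rewrite extended-at L p | Lₚ = cut refl
... | no i≢p = keep (extended-off L i≢p)

inject₁-cancel-< : {i k : Fin n} → inject₁ i Fin.< inject₁ k → i Fin.< k
inject₁-cancel-< {i = i} {k} = subst₂ _<_ (toℕ-inject₁ i) (toℕ-inject₁ k)

fromℕ≮ : (i : Fin (suc n)) → ¬ (fromℕ n Fin.< i)
fromℕ≮ {n} i n<i = <-irrefl (toℕ-fromℕ n) (<-≤-trans n<i (s≤s⁻¹ (toℕ<n i)))

-- The new label exceeds all old ones, and its node comes last and ends the only new edge.
attach-valid : {t : Parents n} {L : Vec (LabelSet m) n} (p : Fin n) → Valid t L →
               Valid (t ▷ p) (attached L)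
attach-valid {n} {m} {t} {L} p v = record { sorted = srt ; node = nd ; increasing = inc }
  where
  L′ = attached L
  srt : ∀ {i k} → i Fin.< k → minL (lookup L′ i) < minL (lookup L′ k)
  srt {i} {k} i<k with view i | view k
  ... | ‵fromℕ | _ = contradiction i<k (fromℕ≮ k)
  ... | ‵inject₁ i | ‵fromℕ rewrite attached-off L i | attached-at L | minL-injectL (lookup L i) | toℕ-fromℕ m
    = minL<m (lookup L i)
  ... | ‵inject₁ i | ‵inject₁ k
    rewrite attached-off L i | attached-off L k | minL-injectL (lookup L i) | minL-injectL (lookup L k)
    = sorted v (inject₁-cancel-< i<k)
  nd : ∀ ℓ → UniqueNode ℓ L′
  nd ℓ with view ℓ
  ... | ‵fromℕ = fromℕ n , subst (fromℕ m ∈ᴸ_) (sym (attached-at L)) refl , uniq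
    where
    uniq : ∀ k → fromℕ m ∈ᴸ lookup L′ k → fromℕ n ≡ k
    uniq k ∈k with view k
    ... | ‵fromℕ = refl
    ... | ‵inject₁ k = contradiction (subst (fromℕ m ∈ᴸ_) (attached-off L k) ∈k) (fromℕ∉injectL (lookup L k))
  ... | ‵inject₁ ℓ with i , ∈i , u ← node v ℓ =
    inject₁ i , subst (inject₁ ℓ ∈ᴸ_) (sym (attached-off L i)) (∈-injectL⁺ (lookup L i) ∈i) , uniq
    where
    uniq : ∀ k → inject₁ ℓ ∈ᴸ lookup L′ k → inject₁ i ≡ k
    uniq k ∈k with view k
    ... | ‵fromℕ = contradiction (sym (subst (inject₁ ℓ ∈ᴸ_) (attached-at L) ∈k)) fromℕ≢inject₁
    ... | ‵inject₁ k = cong inject₁ (u k (∈-injectL⁻ (lookup L k) (subst (inject₁ ℓ ∈ᴸ_) (attached-off L k) ∈k)))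
  inc : ∀ {i k} → Edge (t ▷ p) i k → maxL (lookup L′ i) < minL (lookup L′ k)
  inc new rewrite attached-off L p | attached-at L | maxL-injectL (lookup L p) | toℕ-fromℕ m = maxL<m (lookup L p)
  inc (old {i = i} {k} e)
    rewrite attached-off L i | attached-off L k | maxL-injectL (lookup L i) | minL-injectL (lookup L k)
    = increasing v e

-- Minima do not change, and only the maximum at `p` grows. That maximum matters only on edges
-- leaving `p`, and a leaf has none.
extend-valid : {t : Parents n} {L : Vec (LabelSet m) n} (p : Fin n) {a : Fin m} → lookup L p ≡ one a → Leaf t p →
               Valid t L → Valid t (extended L p)
extend-valid {n} {m} {t} {L} p {a} Lₚ leaf v = record { sorted = srt ; node = nd ; increasing = inc }
  where
  L′ = extended L p
  drop = extended-drop L p Lₚ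
  srt : ∀ {i k} → i Fin.< k → minL (lookup L′ i) < minL (lookup L′ k)
  srt {i} {k} i<k rewrite DropMax-minL (drop i) | DropMax-minL (drop k) = sorted v i<k
  nd : ∀ ℓ → UniqueNode ℓ L′
  nd ℓ with view ℓ
  ... | ‵inject₁ ℓ with i , ∈i , u ← node v ℓ = i , DropMax-∈⁺ (drop i) ∈i , λ k ∈k → u k (DropMax-∈⁻ (drop k) ∈k)
  ... | ‵fromℕ = p , subst (fromℕ m ∈ᴸ_) (sym (trans (extended-at L p) (cong addMax Lₚ))) (inj₂ refl) , uniq
    where
    uniq : ∀ k → fromℕ m ∈ᴸ lookup L′ k → p ≡ k
    uniq k ∈k with k Fin.≟ p
    ... | yes refl = refl
    ... | no k≢p = contradiction (subst (fromℕ m ∈ᴸ_) (extended-off L k≢p) ∈k) (fromℕ∉injectL (lookup L k))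
  inc : ∀ {i k} → Edge t i k → maxL (lookup L′ i) < minL (lookup L′ k)
  inc {i} {k} e with i Fin.≟ p
  ... | yes refl = contradiction e leaf
  ... | no i≢p rewrite extended-off L i≢p | DropMax-minL (drop k) | maxL-injectL (lookup L i) = increasing v e

-- Extensible nodes in the multilabelled tree

injectL-one : (A : LabelSet m) {a : Fin (suc m)} → injectL A ≡ one a → ∃ λ b → A ≡ one b
injectL-one (one b) _ = b , refl

addMax≢one : (A : LabelSet m) {a : Fin (suc m)} → addMax A ≢ one a
addMax≢one (one _) ()
addMax≢one (two _ _ _) ()

Leaf-new : (t : Parents n) (p : Fin n) → Leaf (t ▷ p) (fromℕ n)
Leaf-new t p e = no-edge e refl
  where
  -- The source is a variable constrained by an equation so that the edge can be matched on.
  no-edge : ∀ {i k} → Edge (t ▷ p) i k → i ≢ fromℕ _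
  no-edge new     eq = fromℕ≢inject₁ (sym eq)
  no-edge (old _) eq = fromℕ≢inject₁ (sym eq)

Leaf-old⁺ : {t : Parents n} {p i : Fin n} → i ≢ p → Leaf t i → Leaf (t ▷ p) (inject₁ i)
Leaf-old⁺ {t = t} {p} i≢p leaf e = no-edge e refl
  where
  no-edge : ∀ {x k} → Edge (t ▷ p) x k → x ≢ inject₁ _
  no-edge new     eq = i≢p (sym (inject₁-injective eq))
  no-edge (old e) eq with refl ← inject₁-injective eq = leaf e

-- The flag is set when a node arrives as a unilabelled leaf and cleared as soon as it gets a child
-- or a second label.
extensible⇒one : (h : History j m n) (p : Fin n) → lookup (extensible h) p ≡ true →
                 (∃ λ a → lookup (tLabels h) p ≡ one a) × Leaf (tParents h) p
extensible⇒one (start _) zero ()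
extensible⇒one (attach h q) p e with view p
... | ‵fromℕ = (_ , attached-at (tLabels h)) , Leaf-new (tParents h) q
... | ‵inject₁ i
  with i≢q , e′ ← cleared (extensible h) q i (trans (sym (lookup-∷ʳ-inject₁ (extensible h [ q ]≔ false) true i)) e)
  with (a , Lᵢ) , leaf ← extensible⇒one h i e′ =
  (inject₁ a , trans (attached-off (tLabels h) i) (cong injectL Lᵢ)) , Leaf-old⁺ i≢q leaf
extensible⇒one (extend h q _) i e
  with i≢q , e′ ← cleared (extensible h) q i e
  with (a , Lᵢ) , leaf ← extensible⇒one h i e′ =
  (inject₁ a , trans (extended-off (tLabels h) i≢q) (cong injectL Lᵢ)) , leaf

-- The exceptional history: a lone root with label set {1} is a unilabelled leaf but not extensible.
data IsStart : History j m n → Set where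
  isStart : IsStart (start same)

one⇒extensible : (h : History j m n) (p : Fin n) {a : Fin m} → lookup (tLabels h) p ≡ one a → Leaf (tParents h) p →
                 lookup (extensible h) p ≡ true ⊎ IsStart h
one⇒extensible (start same) zero _ _ = inj₂ isStart
one⇒extensible (start next) zero ()
one⇒extensible (attach h q) p Lₚ leaf with view p
... | ‵fromℕ = inj₁ (lookup-∷ʳ-fromℕ (extensible h [ q ]≔ false) true)
... | ‵inject₁ i with i Fin.≟ q
...   | yes refl = contradiction new leaf
...   | no i≢q with _ , Lᵢ ← injectL-one (lookup (tLabels h) i) (trans (sym (attached-off (tLabels h) i)) Lₚ)
               with one⇒extensible h i Lᵢ (leaf ∘ old)
...     | inj₁ e = inj₁ (trans (lookup-∷ʳ-inject₁ (extensible h [ q ]≔ false) true i)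
                               (trans (lookup∘update′ i≢q (extensible h) false) e))
-- With a single old node, `i` can only be `q`.
one⇒extensible (attach _ zero) _ _ _ | ‵inject₁ zero | no i≢q | inj₂ isStart = contradiction refl i≢q
one⇒extensible (extend h q e) i Lᵢ leaf with i Fin.≟ q
... | yes refl = contradiction (trans (sym (extended-at (tLabels h) i)) Lᵢ) (addMax≢one (lookup (tLabels h) i))
... | no i≢q with _ , Lᵢ′ ← injectL-one (lookup (tLabels h) i) (trans (sym (extended-off (tLabels h) i≢q)) Lᵢ)
             with one⇒extensible h i Lᵢ′ leaf
...   | inj₁ e′ = inj₁ (trans (lookup∘update′ i≢q (extensible h) false) e′)
-- The lone root is not extensible, so this step does not exist.
one⇒extensible (extend _ zero ()) _ _ _ | no _ | inj₂ isStart

history-valid : (h : History j m n) → Valid (tParents h) (tLabels h)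
history-valid (start same) = record
  { sorted     = λ { {zero} {zero} () }
  ; node       = λ { zero → zero , refl , λ { zero _ → refl } }
  ; increasing = λ () }
history-valid (start next) = record
  { sorted     = λ { {zero} {zero} () }
  ; node       = λ { zero → zero , inj₁ refl , λ { zero _ → refl } ; (suc zero) → zero , inj₂ refl , λ { zero _ → refl } }
  ; increasing = λ () }
history-valid (attach h p) = attach-valid p (history-valid h)
history-valid (extend h p e) with (_ , Lₚ) , leaf ← extensible⇒one h p e = extend-valid p Lₚ leaf (history-valid h)

toTHat : History j m n → THat m
toTHat h = Valid⇒THat (tParents h) (tLabels h) (history-valid h)

-- Recovering a history from a multilabelled tree

extended≢one-fromℕ : (L : Vec (LabelSet m) n) (p i : Fin n) → lookup (extended L p) i ≢ one (fromℕ m)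
extended≢one-fromℕ {m} L p i eq with i Fin.≟ p
... | yes refl = addMax≢one (lookup L p) (trans (sym (extended-at L p)) eq)
... | no i≢p   = fromℕ∉injectL (lookup L i) (subst (fromℕ m ∈ᴸ_) (trans (sym eq) (extended-off L i≢p)) refl)

-- The largest label lies in the set at `p`, while away from `p′` no set contains it.
extended-node : (L L′ : Vec (LabelSet m) n) {p p′ : Fin n} {a : Fin m} → lookup L p ≡ one a →
                extended L p ≡ extended L′ p′ → p ≡ p′
extended-node {m} L L′ {p} {p′} Lₚ eq with p Fin.≟ p′
... | yes p≡p′ = p≡p′
... | no p≢p′ = contradiction (subst (fromℕ m ∈ᴸ_) addMax≡injectL (inj₂ refl)) (fromℕ∉injectL (lookup L′ p))
  where
  addMax≡injectL : addMax (one _) ≡ injectL (lookup L′ p)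
  addMax≡injectL = trans (sym (trans (extended-at L p) (cong addMax Lₚ)))
                         (trans (cong (λ v → lookup v p) eq) (extended-off L′ p≢p′))

-- The largest label reveals the last step: after `attach` it is alone on the last node, after
-- `extend` it is the second label of `p`.
t-injective : ∀ {i j} (h : History i m n) (h′ : History j m n) →
              tParents h ≡ tParents h′ → tLabels h ≡ tLabels h′ → _≡_ {A = ∃ λ j → History j m n} (i , h) (j , h′)
t-injective (start o) (start o′) _ _ = cong (λ o → 1 , start o) (Offset-irrelevant o o′)
t-injective (start _) (attach _ ()) _ _
t-injective (attach _ ()) (start _) _ _
-- Here `zero` is the largest label and alone in its set, which no extension produces.
t-injective (start same) (extend h p e) _ L≡ =
  contradiction (cong (λ v → lookup v zero) (sym L≡)) (extended≢one-fromℕ (tLabels h) p zero)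
t-injective (extend h p e) (start same) _ L≡ =
  contradiction (cong (λ v → lookup v zero) L≡) (extended≢one-fromℕ (tLabels h) p zero)
-- Two labels on a single node would require extending the root {1}, which is not extensible.
t-injective (start next) (extend (start same) zero ()) _ _
t-injective (start next) (extend (attach _ ()) _ _) _ _
t-injective (start next) (extend (extend (start ()) _ _) _ _) _ _
t-injective (extend (start same) zero ()) (start next) _ _
t-injective (extend (attach _ ()) _ _) (start next) _ _
t-injective (extend (extend (start ()) _ _) _ _) (start next) _ _
t-injective (attach h p) (extend h′ p′ e′) _ L≡ = contradiction
  (trans (cong (λ v → lookup v (fromℕ _)) (sym L≡)) (attached-at (tLabels h))) (extended≢one-fromℕ (tLabels h′) p′ _)
t-injective (extend h p e) (attach h′ p′) _ L≡ = contradiction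
  (trans (cong (λ v → lookup v (fromℕ _)) L≡) (attached-at (tLabels h′))) (extended≢one-fromℕ (tLabels h) p _)
t-injective (attach h p) (attach h′ p′) t≡ L≡
  with t≡′ , refl ← ▷-injective t≡
  with refl ← t-injective h h′ t≡′ (lookup-ext λ i → injectL-injective
    (trans (sym (attached-off (tLabels h) i))
           (trans (cong (λ v → lookup v (inject₁ i)) L≡) (attached-off (tLabels h′) i)))) = refl
t-injective (extend h p e) (extend h′ p′ e′) t≡ L≡
  with (_ , Lₚ) , _ ← extensible⇒one h p e | (_ , L′ₚ) , _ ← extensible⇒one h′ p′ e′
  with refl ← t-injective h h′ t≡ (lookup-ext λ i → DropMax-deterministic
    (extended-drop (tLabels h) p Lₚ i)
    (subst (λ v → DropMax (lookup v i) (lookup (tLabels h′) i)) (sym L≡) (extended-drop (tLabels h′) p′ L′ₚ i)))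
  = cong (_ ,_) (extend-cong h (extended-node (tLabels h) (tLabels h) Lₚ L≡))

-- Used to remove the largest label: `f` embeds the remaining nodes, as `inject₁` when the last node
-- goes and as `id` when only a label goes.
DropMax-valid : ∀ {n n′} {t : Parents n} {t′ : Parents n′} {L : Vec (LabelSet m) n} {L′ : Vec (LabelSet (suc m)) n′}
  (f : Fin n → Fin n′) → (∀ {i k} → f i ≡ f k → i ≡ k) → (∀ {i k} → i Fin.< k → f i Fin.< f k) →
  (∀ {i k} → Edge t i k → Edge t′ (f i) (f k)) →
  (∀ ℓ i → inject₁ ℓ ∈ᴸ lookup L′ i → ∃ λ k → f k ≡ i) →
  (∀ i → DropMax (lookup L′ (f i)) (lookup L i)) → Valid t′ L′ → Valid t L
DropMax-valid {m} {n} {L = L} {L′} f f-inj f-mono f-edge f-hits drop v = record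
  { sorted     = λ i<k → subst₂ _<_ (DropMax-minL (drop _)) (DropMax-minL (drop _)) (sorted v (f-mono i<k))
  ; node       = nd
  ; increasing = λ {i} {k} e → ℕ.≤-<-trans (DropMax-maxL (drop i))
                                 (subst (maxL (lookup L′ (f i)) <_) (DropMax-minL (drop k)) (increasing v (f-edge e)))
  }
  where
  nd : ∀ ℓ → UniqueNode ℓ L
  nd ℓ with i , ∈i , uniq ← node v (inject₁ ℓ) with k , refl ← f-hits ℓ i ∈i =
    k , DropMax-∈⁻ (drop k) ∈i , λ k′ ∈k′ → f-inj (uniq (f k′) (DropMax-∈⁺ (drop k′) ∈k′))

Realised : Parents n → Vec (LabelSet m) n → Set
Realised {n} {m} t L = ∃ λ j → Σ (History j m n) λ h → tParents h ≡ t × tLabels h ≡ L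

AllRealised : ℕ → Set
AllRealised m = ∀ {n} (t : Parents n) (L : Vec (LabelSet m) n) → Valid t L → Realised t L

-- Sortedness puts the node with only the largest label last; removing it undoes an `attach`, unless
-- it is the root.
realised-one : AllRealised m → (t : Parents n) (L : Vec (LabelSet (suc m)) n) → Valid t L →
               (p : Fin n) → lookup L p ≡ one (fromℕ m) → (∀ k → fromℕ m ∈ᴸ lookup L k → p ≡ k) → Realised t L
realised-one {zero}  _  root (A ∷ []) v zero refl _ = 1 , start same , refl , refl
-- The only node would have to hold `zero` too, but its one label is the largest of at least two.
realised-one {suc m} _  root (A ∷ []) v zero refl _ with node v zero
... | zero , () , _
realised-one {m} {suc n} ih (t ▷ q) L v p Lₚ uniq with view p
-- Otherwise the minimum at the last node would exceed every label.
... | ‵inject₁ i = contradiction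
  (subst (_< minL (lookup L (fromℕ n))) (trans (cong minL Lₚ) (toℕ-fromℕ m)) (sorted v (inject-<-fromℕ i)))
  (ℕ.<⇒≱ (minL<m (lookup L (fromℕ n))))
... | ‵fromℕ = result (ih t L₀ valid₀)
  where
  kept : (i : Fin n) → ∃ λ B → lookup L (inject₁ i) ≡ injectL B
  kept i = fromℕ∉⇒injectL (lookup L (inject₁ i)) (fromℕ≢inject₁ ∘ uniq (inject₁ i))
  L₀ : Vec (LabelSet m) n
  L₀ = tabulate (proj₁ ∘ kept)
  L₀-kept : ∀ i → lookup L (inject₁ i) ≡ injectL (lookup L₀ i)
  L₀-kept i = trans (proj₂ (kept i)) (cong injectL (sym (lookup∘tabulate (proj₁ ∘ kept) i)))
  hits : ∀ ℓ i → inject₁ ℓ ∈ᴸ lookup L i → ∃ λ k → inject₁ k ≡ i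
  hits ℓ i ∈i with view i
  ... | ‵inject₁ k = k , refl
  ... | ‵fromℕ     = contradiction (sym (subst (inject₁ ℓ ∈ᴸ_) Lₚ ∈i)) fromℕ≢inject₁
  valid₀ : Valid t L₀
  valid₀ = DropMax-valid inject₁ inject₁-injective inject-< old hits (keep ∘ L₀-kept) v
  result : Realised t L₀ → Realised (t ▷ q) L
  result (j , h , refl , L≡) = suc j , attach h q , refl , lookup-ext labels
    where
    labels : ∀ i → lookup (tLabels (attach h q)) i ≡ lookup L i
    labels i with view i
    ... | ‵fromℕ     = trans (attached-at (tLabels h)) (sym Lₚ)
    ... | ‵inject₁ i = trans (attached-off (tLabels h) i)
                             (trans (cong (λ v → injectL (lookup v i)) L≡) (sym (L₀-kept i)))

-- Returning the second label to the lone root {1} is not an extension; it gives `start next`.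
realised-start : {h : History j m n} → IsStart h → (L : Vec (LabelSet (suc m)) n) (p : Fin n) (a : Fin m) →
                 lookup L p ≡ addMax (one a) → Realised (tParents h) L
realised-start isStart (_ ∷ []) zero zero refl = 1 , start next , refl , cong (_∷ []) (two-cong refl refl)

-- A child of `p` would need a label above the largest one, so `p` is a leaf and removing that label
-- leaves a unilabelled leaf.
realised-two : AllRealised m → (t : Parents n) (L : Vec (LabelSet (suc m)) n) → Valid t L →
               (p : Fin n) (a : Fin m) → lookup L p ≡ addMax (one a) → (∀ k → fromℕ m ∈ᴸ lookup L k → p ≡ k) → Realised t L
realised-two {m} {n} ih t L v p a Lₚ uniq = result (ih t L₀ valid₀)
  where
  -- The two implications preserve the outcome of comparing `i` with `p` for later use.
  dropped : (i : Fin n) → ∃ λ B → DropMax (lookup L i) B × (i ≢ p → lookup L i ≡ injectL B) × (i ≡ p → B ≡ one a)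
  dropped i with i Fin.≟ p
  ... | yes refl = one a , cut Lₚ , (λ i≢i → contradiction refl i≢i) , λ _ → refl
  ... | no i≢p with B , Lᵢ ← fromℕ∉⇒injectL (lookup L i) (i≢p ∘ sym ∘ uniq i) =
    B , keep Lᵢ , (λ _ → Lᵢ) , λ i≡p → contradiction i≡p i≢p
  L₀ : Vec (LabelSet m) n
  L₀ = tabulate (proj₁ ∘ dropped)
  L₀ᵢ : ∀ i → lookup L₀ i ≡ proj₁ (dropped i)
  L₀ᵢ = lookup∘tabulate (proj₁ ∘ dropped)
  valid₀ : Valid t L₀
  valid₀ = DropMax-valid id id id id (λ _ i _ → i , refl)
    (λ i → subst (DropMax (lookup L i)) (sym (L₀ᵢ i)) (proj₁ (proj₂ (dropped i)))) v
  leaf : Leaf t p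
  leaf {k} e = ℕ.<⇒≱ (minL<m (lookup L k)) 
    (subst (_< minL (lookup L k)) (trans (cong maxL Lₚ) (toℕ-fromℕ m)) (increasing v e))
  result : Realised t L₀ → Realised t L
  result (j , h , refl , L≡) with one⇒extensible h p
    (trans (cong (λ v → lookup v p) L≡) (trans (L₀ᵢ p) (proj₂ (proj₂ (proj₂ (dropped p))) refl))) leaf
  ... | inj₁ e = suc j , extend h p e , refl , lookup-ext labels
    where
    labels : ∀ i → lookup (tLabels (extend h p e)) i ≡ lookup L i
    labels i with i Fin.≟ p
    ... | yes refl = trans (extended-at (tLabels h) i) (trans
          (cong addMax (trans (cong (λ v → lookup v i) L≡) (trans (L₀ᵢ i) (proj₂ (proj₂ (proj₂ (dropped i))) refl))))
          (sym Lₚ))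
    ... | no i≢p = trans (extended-off (tLabels h) i≢p) (trans
          (cong injectL (trans (cong (λ v → lookup v i) L≡) (L₀ᵢ i))) (sym (proj₁ (proj₂ (proj₂ (dropped i))) i≢p)))
  ... | inj₂ s = realised-start s L p a Lₚ

realised : ∀ m → AllRealised m
-- Every tree has a node, but without labels there is no label set for it.
realised zero root (one () ∷ _) _
realised zero root (two () _ _ ∷ _) _
realised zero (_ ▷ _) (one () ∷ _) _
realised zero (_ ▷ _) (two () _ _ ∷ _) _
realised (suc m) t L v with p , ∈p , uniq ← node v (fromℕ m) with lookup L p in Lₚ
... | one _ with refl ← ∈p = realised-one (realised m) t L v p Lₚ uniq
... | two a b a<b with ∈p
...   | inj₁ refl = contradiction a<b (fromℕ≮ b)
...   | inj₂ refl with ≢fromℕ⇒inject₁ a (λ { refl → <-irrefl refl a<b })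
...     | a′ , refl = realised-two (realised m) t L v p a′ (trans Lₚ (two-cong refl refl)) uniq

-- The two bijections from histories

Histories : ℕ → Set
Histories m = ∃ λ j → ∃ λ n → History j m n

-- Node numbers are compared first, so that both histories lie over the same `n`.
t-shape-injective : ∀ {i j n n′} (h : History i m n) (h′ : History j m n′) (n≡ : n ≡ n′) →
  subst (Shape m) n≡ (tParents h , tLabels h) ≡ (tParents h′ , tLabels h′) → _≡_ {A = Histories m} (i , n , h) (j , n′ , h′)
t-shape-injective h h′ refl eq with refl ← t-injective h h′ (cong proj₁ eq) (cong proj₂ eq) = refl

Histories⤖THat : ∀ m → Histories m ⤖ THat m
Histories⤖THat m = mk⤖ {to = to} (injective , strictlySurjective⇒surjective surjective)
  where
  to : Histories m → THat m
  to (_ , _ , h) = toTHat h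
  injective : ∀ {x y} → to x ≡ to y → x ≡ y
  injective {_ , _ , h} {_ , _ , h′} eq = t-shape-injective h h′ (,-injectiveˡ shapes) (,-injectiveʳ-≡ uip shapes _)
    where shapes = cong shape eq
  surjective : ∀ T → ∃ λ x → to x ≡ T
  surjective T with realised m (THat.tree T) (THat.labels T) (THat⇒Valid T)
  ... | j , h , refl , refl = (j , _ , h) , shape-injective refl

-- The offset tells whether the coloured tree has `suc m` or `m` nodes, and thereby selects the
-- summand.
Histories⤖QHat : ∀ m → Histories (suc m) ⤖ (QHat (suc m) ⊎ QHat m)
Histories⤖QHat m = mk⤖ {to = to} ((λ {x} {y} → injective x y) , strictlySurjective⇒surjective surjective)
  where
  place : Offset j (suc m) → QHat j → QHat (suc m) ⊎ QHat m
  place same q = inj₁ q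
  place next q = inj₂ q
  to : Histories (suc m) → QHat (suc m) ⊎ QHat m
  to (_ , _ , h) = place (offset h) (toQHat h)
  fibre : ∀ {n n′} (h : History j (suc m) n) (h′ : History j (suc m) n′) → toQHat h ≡ toQHat h′ →
          _≡_ {A = Histories (suc m)} (j , n , h) (j , n′ , h′)
  fibre h h′ eq = cong (_ ,_) (q-injective h h′ (cong QHat.tree eq) (cong QHat.colour eq))
  injective : ∀ x y → to x ≡ to y → x ≡ y
  injective (_ , _ , h) (_ , _ , h′) eq with offset h | offset h′
  ... | same | same = fibre h h′ (inj₁-injective eq)
  ... | next | next = fibre h h′ (inj₂-injective eq)
  ... | same | next with () ← eq
  ... | next | same with () ← eq
  -- The history found by `coloured` carries its own offset, which must select the same summand as
  -- `o`.
  place-unique : (o o′ : Offset j (suc m)) (q : QHat j) → place o q ≡ place o′ q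
  place-unique same same q = refl
  place-unique next next q = refl
  reach : (o : Offset j (suc m)) (q : QHat j) → ∃ λ x → to x ≡ place o q
  reach o q with coloured (QHat.tree q) (QHat.colour q) (Pointwise⇒AllAllowed (QHat.tree q) _ (QHat.colourOK q)) o
  ... | n , h , t≡ , c≡ = (_ , n , h) , trans (place-unique (offset h) o _) (cong (place o) (QHat-≡ t≡ c≡))
  surjective : ∀ q → ∃ λ x → to x ≡ q
  surjective (inj₁ q) = reach same q
  surjective (inj₂ q) = reach next q

theorem8p3 : (m : ℕ) → 1 ≤ m → THat m ⤖ (QHat m ⊎ QHat (m ∸ 1))
theorem8p3 (suc m) _ = ↔⇒⤖ (↔-trans (↔-sym (⤖⇒↔ (Histories⤖THat (suc m)))) (⤖⇒↔ (Histories⤖QHat m)))
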